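{- Let $d_n$ denote the number of derangements of $n$ elements (permutations of $\{1,\dots,n\}$ with no fixed points). Then the sequence $\{d_n\}_{n\ge 3}$ is asymptotically infinitely log-monotonic: for every integer $k\ge 0$ there exists $N\ge 3$ such that $\{d_n\}_{n\ge N}$ is log-monotonic of order $k$.
   Context: For a sequence $\{z_n\}$ of positive numbers, define the operator $R\{z_n\}=\{z_{n+1}/z_n\}$. A sequence of positive numbers $\{x_n\}$ is log-convex if $x_{n-1}x_{n+1}\ge x_n^2$ and log-concave if $x_{n-1}x_{n+1}\le x_n^2$, for all indices where these terms are defined. A sequence $\{z_n\}$ is log-monotonic of order $k$ if for every odd $r\le k-1$ the sequence $R^r\{z_n\}$ is log-concave and for every even $r\le k-1$ (including $r=0$) the sequence $R^r\{z_n\}$ is log-convex. -}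

module Defs where

open import Data.Fin.Base using (Fin; zero; suc; fromℕ; inject₁; toℕ)
open import Data.Fin.Properties
  using (_≟_; all?; any?; toℕ-inject₁; fromℕ≢inject₁; inject₁-injective)
open import Data.Fin.Relation.Unary.Top using (view; ‵fromℕ; ‵inject₁)
open import Data.Integer.Base using (+_)
open import Data.List.Base
  using (List; []; [_]; allFin; cartesianProductWith; filter; length)
open import Data.List.Membership.Propositional using (_∈_; lose)
open import Data.List.Membership.Propositional.Properties
  using (∈-allFin; ∈-cartesianProductWith⁺)
open import Data.List.Properties using (filter-some)
open import Data.List.Relation.Unary.Any using (here)
open import Data.Nat.Base as ℕ using (ℕ; zero; suc; z≤n; s≤s)
open import Data.Nat.Divisibility using (_∣_; _∤_)
import Data.Nat.Properties as ℕ
open import Data.Product.Base using (_×_; _,_; ∃)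
open import Data.Rational.Base
  using (ℚ; Positive; _/_; _÷_; _*_; _≤_; _≥_; 1/_)
open import Data.Rational.Properties
  using (pos⇒nonZero; pos*pos⇒pos; 1/pos⇒pos; normalize-pos)
open import Data.Vec.Base using (Vec; []; _∷_; lookup; tabulate)
open import Data.Vec.Properties using (lookup∘tabulate)
open import Function.Base using (_∘_)
open import Function.Consequences.Propositional
  using (strictlySurjective⇒surjective; surjective⇒strictlySurjective)
open import Function.Definitions
  using (Injective; Surjective; StrictlySurjective; Bijective)
open import Function.Endo.Propositional using (_^_)
open import Relation.Binary.PropositionalEquality
  using (_≡_; _≢_; refl; sym; trans; cong)
open import Relation.Nullary.Decidable
  using (Dec; map′; ¬?; _×-dec_; _→-dec_)
open import Relation.Nullary.Negation using (contradiction)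

-- A vector v : Vec (Fin n) n is the one-line notation of the map
-- i ↦ lookup v i; vectors have extensional propositional equality, so
-- distinct vectors are distinct maps and counting vectors counts maps.

IsPermutation : ∀ {n} → Vec (Fin n) n → Set
IsPermutation v = Bijective _≡_ _≡_ (lookup v)

IsDerangement : ∀ {n} → Vec (Fin n) n → Set
IsDerangement v = IsPermutation v × (∀ i → lookup v i ≢ i)

isPermutation? : ∀ {n} (v : Vec (Fin n) n) → Dec (IsPermutation v)
isPermutation? {n} v = injective? ×-dec surjective?
  where
  injective? : Dec (Injective _≡_ _≡_ (lookup v))
  injective? =
    map′ (λ h {x} {y} → h x y) (λ h x y → h {x} {y})
      (all? λ x → all? λ y → (lookup v x ≟ lookup v y) →-dec (x ≟ y))

  surjective? : Dec (Surjective _≡_ _≡_ (lookup v))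
  surjective? =
    map′ strictlySurjective⇒surjective surjective⇒strictlySurjective
      (all? λ y → any? λ x → lookup v x ≟ y)

isDerangement? : ∀ {n} (v : Vec (Fin n) n) → Dec (IsDerangement v)
isDerangement? v = isPermutation? v ×-dec all? λ i → ¬? (lookup v i ≟ i)

-- All vectors of length m with entries in Fin n, each listed exactly once.
words : ∀ n m → List (Vec (Fin n) m)
words n zero    = [ [] ]
words n (suc m) = cartesianProductWith _∷_ (allFin n) (words n m)

d : ℕ → ℕ
d n = length (filter isDerangement? (words n n))

∈-words : ∀ {n m} (v : Vec (Fin n) m) → v ∈ words n m
∈-words []      = here refl
∈-words (x ∷ v) = ∈-cartesianProductWith⁺ _∷_ (∈-allFin x) (∈-words v)

derangement⇒d>0 : ∀ {n} (v : Vec (Fin n) n) → IsDerangement v → d n ℕ.> 0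
derangement⇒d>0 v v-der = filter-some isDerangement? (lose (∈-words v) v-der)

-- For n ≥ 2 the cyclic shift i ↦ i - 1 (mod n) is a derangement.
d>0 : ∀ {n} → n ℕ.≥ 2 → d n ℕ.> 0
d>0 {suc (suc m)} (s≤s (s≤s _)) =
  derangement⇒d>0 v ((injective , strictlySurjective⇒surjective surjective) , moves)
  where
  shift : Fin (suc (suc m)) → Fin (suc (suc m))
  shift zero    = fromℕ (suc m)
  shift (suc i) = inject₁ i

  v : Vec (Fin (suc (suc m))) (suc (suc m))
  v = tabulate shift

  v≗shift : ∀ i → lookup v i ≡ shift i
  v≗shift = lookup∘tabulate shift

  shift-injective : ∀ x y → shift x ≡ shift y → x ≡ y
  shift-injective zero    zero    eq = refl
  shift-injective zero    (suc y) eq = contradiction eq fromℕ≢inject₁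
  shift-injective (suc x) zero    eq = contradiction (sym eq) fromℕ≢inject₁
  shift-injective (suc x) (suc y) eq = cong suc (inject₁-injective eq)

  injective : Injective _≡_ _≡_ (lookup v)
  injective {x} {y} eq =
    shift-injective x y (trans (sym (v≗shift x)) (trans eq (v≗shift y)))

  shift-surjective : ∀ y → ∃ λ x → shift x ≡ y
  shift-surjective y with view y
  ... | ‵fromℕ     = zero , refl
  ... | ‵inject₁ i = suc i , refl

  surjective : StrictlySurjective _≡_ (lookup v)
  surjective y with x , eq ← shift-surjective y = x , trans (v≗shift x) eq

  shift-moves : ∀ i → shift i ≢ i
  shift-moves zero    ()
  shift-moves (suc i) eq =
    ℕ.1+n≢n (trans (sym (cong toℕ eq)) (toℕ-inject₁ i))

  moves : ∀ i → lookup v i ≢ i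
  moves i eq = shift-moves i (trans (sym (v≗shift i)) eq)

-- The positive numbers are taken to be rational: every sequence obtained
-- from integers by iterating R has rational terms.

record ℚ⁺ : Set where
  field
    value   : ℚ
    value>0 : Positive value

open ℚ⁺ public

infixl 7 _÷⁺_

_÷⁺_ : ℚ⁺ → ℚ⁺ → ℚ⁺
p ÷⁺ q = record
  { value   = value p ÷ value q
  ; value>0 = pos*pos⇒pos (value p) (1/ value q) {{1/pos⇒pos (value q)}}
  }
  where instance
  _ = value>0 p
  _ = value>0 q
  _ = pos⇒nonZero (value q)

-- A sequence {z_n}_{n ≥ N} is stored with its indices shifted down by N;
-- the notions below do not depend on the shift.
PositiveSequence : Set
PositiveSequence = ℕ → ℚ⁺

LogConvex LogConcave : PositiveSequence → Set
LogConvex  x = ∀ n →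
  value (x n) * value (x (2 ℕ.+ n)) ≥ value (x (1 ℕ.+ n)) * value (x (1 ℕ.+ n))
LogConcave x = ∀ n →
  value (x n) * value (x (2 ℕ.+ n)) ≤ value (x (1 ℕ.+ n)) * value (x (1 ℕ.+ n))

R : PositiveSequence → PositiveSequence
R z n = z (suc n) ÷⁺ z n

-- The bound r ≤ k - 1 is written r < k, so that order 0 imposes nothing.
LogMonotonic : ℕ → PositiveSequence → Set
LogMonotonic k z = ∀ r → r ℕ.< k →
  (2 ∤ r → LogConcave ((PositiveSequence ^ R) r z)) ×
  (2 ∣ r → LogConvex  ((PositiveSequence ^ R) r z))

fromℕ⁺ : (n : ℕ) → n ℕ.> 0 → ℚ⁺
fromℕ⁺ n n>0 = record
  { value   = + n / 1
  ; value>0 = normalize-pos n 1 {{_}} {{ℕ.>-nonZero n>0}}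
  }

derangementsFrom : (N : ℕ) → N ℕ.≥ 3 → PositiveSequence
derangementsFrom N N≥3 i = fromℕ⁺ (d (N ℕ.+ i))
  (d>0 (ℕ.≤-trans (ℕ.n≤1+n 2) (ℕ.≤-trans N≥3 (ℕ.m≤m+n N i))))

{-# OPTIONS --safe #-}

-- Write a sequence of positive rationals as X n / Y n with natural X and Y.  Up
-- to inversion, R replaces (X , Y) by ∇ (X , Y) = (X n · Y (n+1) , Y n · X (n+1)),
-- and every inequality to be proved says that the second component of
-- ∇^ (r + 2) (d , 1) is eventually at most the first.
--
-- If d (n+1) were exactly (n + 1) · d n, then ∇^ (s + 2) (d , 1) would be, up to a
-- common factor, a pair (P , Q) of polynomials obtained by applying ∇ to
-- (n + 2 , n + 1).  Such a pair satisfies Q < P eventually and P / Q → 1, by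
-- induction: P′ − Q′ for (P′ , Q′) = ∇ (P , Q) is a polynomial, so eventually of
-- constant sign, and P′ ≤ Q′ would make P / Q nondecreasing, contradicting the
-- limit.
--
-- In truth d (n+1) = (n + 1) · d n ± 1.  This introduces relative errors O(1 / d n)
-- into both components, while P − Q ≥ 1 is a relative gap of only polynomial
-- smallness, and d grows faster than every polynomial.
module Submission where

open import Algebra.Bundles using (CommutativeMonoid)
open import Data.Fin.Base using (Fin; zero; suc; punchIn; punchOut)
open import Data.Fin.Permutation
  using (Permutation′; _⟨$⟩ʳ_; _⟨$⟩ˡ_; inverseˡ; inverseʳ; flip; transpose; lift₀; remove; insert;
         _∘ₚ_; lift₀-remove; lift₀-cong; punchIn-permute; insert-remove; remove-insert; ↔⇒≡)
open import Data.Fin.Properties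
  using (_≟_; suc-injective; punchIn-injective; punchInᵢ≢i; punchIn-punchOut; punchOut-cong;
         +↔⊎; *↔×)
open import Data.Integer.Base as ℤ using (ℤ; +_; 0ℤ; ∣_∣)
import Data.Integer.Properties as ℤ
import Data.Integer.Tactic.RingSolver as ℤ-Ring
open import Data.List.Base using (List; filter; lookup)
open import Data.List.Membership.Propositional using (_∈_)
open import Data.List.Membership.Propositional.Properties using (∈-filter⁺; ∈-filter⁻; ∈-lookup)
open import Data.List.Relation.Unary.All as All using ()
open import Data.List.Relation.Unary.AllPairs using ([]; _∷_)
open import Data.List.Relation.Unary.Any using (index)
open import Data.List.Relation.Unary.Any.Properties using (lookup-index)
open import Data.List.Relation.Unary.Unique.Propositional using (Unique)
open import Data.List.Relation.Unary.Unique.Propositional.Properties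
  using (allFin⁺; cartesianProductWith⁺; filter⁺)
open import Data.Nat.Base
  using (ℕ; zero; suc; _+_; _*_; _∸_; _⊔_; ∣_-_∣; _≤_; _<_; _≥_; z≤n; s≤s; >-nonZero)
open import Data.Nat.Coprimality as Coprimality using (1-coprimeTo)
open import Data.Nat.Divisibility using (_∣_; _∤_; divides)
import Data.Nat.Properties as ℕ
import Data.Nat.Tactic.RingSolver as ℕ-Ring
open import Data.Product.Base
  using (_×_; _,_; proj₁; proj₂; swap; ∃; ∃-syntax; Σ-syntax)
open import Data.Product.Function.NonDependent.Setoid using (_×-inverse_)
open import Data.Product.Relation.Binary.Pointwise.NonDependent using (_×ₛ_; Pointwise-≡↔≡)
open import Data.Rational.Base as ℚ using (ℚ; 0ℚ; mkℚ; _/_)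
import Data.Rational.Properties as ℚ
open import Data.Sum.Base using (_⊎_; inj₁; inj₂)
open import Data.Sum.Function.Setoid using (_⊎-inverse_)
open import Data.Sum.Relation.Binary.Pointwise as Sum using (_⊎ₛ_; inj₁; inj₂)
open import Data.Vec.Base as Vec using (Vec; _∷_)
open import Data.Vec.Properties using (∷-injective; lookup∘tabulate; tabulate∘lookup; tabulate-cong)
open import Function.Base using (_∘_)
open import Function.Bundles using (Inverse; mk⤖)
open import Function.Consequences.Propositional using (strictlySurjective⇒surjective)
import Function.Consequences.Setoid as Consequences
open import Function.Endo.Propositional using (_^_)
open import Function.Properties.Bijection using (⤖⇒↔; Bijection⇒Inverse)
import Function.Properties.Inverse as Inverse
open import Level using (0ℓ)
open import Relation.Binary.Bundles using (Setoid)
import Relation.Binary.Construct.On as On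
open import Relation.Binary.Definitions using (tri<; tri≈; tri>)
open import Relation.Binary.PropositionalEquality
  using (_≡_; _≢_; refl; sym; trans; cong; cong₂; subst; subst₂; _≗_; _→-setoid_; setoid;
         module ≡-Reasoning)
open import Relation.Nullary.Decidable using (yes; no)
open import Relation.Nullary.Negation using (contradiction)
open import Defs

-- The recurrence of the derangement numbers

unique-words : ∀ n m → Unique (words n m)
unique-words n zero    = All.[] ∷ []
unique-words n (suc m) = cartesianProductWith⁺ _∷_ ∷-injective (allFin⁺ n) (unique-words n m)

lookup-injective : ∀ {A : Set} {xs : List A} → Unique xs →
                   ∀ {i j} → lookup xs i ≡ lookup xs j → i ≡ j
lookup-injective (_ ∷ _)  {zero}  {zero}  _  = refl
lookup-injective (x∉ ∷ _) {zero}  {suc j} eq = contradiction eq (All.lookup x∉ (∈-lookup j))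
lookup-injective (x∉ ∷ _) {suc i} {zero}  eq = contradiction (sym eq) (All.lookup x∉ (∈-lookup i))
lookup-injective (_ ∷ u)  {suc i} {suc j} eq = cong suc (lookup-injective u eq)

-- Only forward maps are compared: a permutation also carries its inverse and proofs, which
-- agreement of the forward maps does not make propositionally equal.
PermutationSetoid : ℕ → Setoid 0ℓ 0ℓ
PermutationSetoid n = On.setoid (Fin n →-setoid Fin n) (_⟨$⟩ʳ_ {n} {n})

DerangementSetoid : ℕ → Setoid 0ℓ 0ℓ
DerangementSetoid n =
  On.setoid {B = Σ[ π ∈ Permutation′ n ] (∀ i → π ⟨$⟩ʳ i ≢ i)} (PermutationSetoid n) proj₁

-- `d n` is the length of a list, so its positions are counted. The list has no repetitions, which
-- gives injectivity, and contains every derangement, which gives surjectivity.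
Fin-d≅Derangement : ∀ n → Inverse (setoid (Fin (d n))) (DerangementSetoid n)
Fin-d≅Derangement n = Bijection⇒Inverse record
  { to        = to
  ; cong      = λ { refl _ → refl }
  ; bijective = injective , surjective
  }
  where
  derangements : List (Vec (Fin n) n)
  derangements = filter isDerangement? (words n n)

  isDerangement : ∀ k → IsDerangement (lookup derangements k)
  isDerangement k = proj₂ (∈-filter⁻ isDerangement? {xs = words n n} (∈-lookup k))

  to : Fin (d n) → Setoid.Carrier (DerangementSetoid n)
  to k = ⤖⇒↔ (mk⤖ (proj₁ (isDerangement k))) , proj₂ (isDerangement k)

  injective : ∀ {k l} → (∀ i → proj₁ (to k) ⟨$⟩ʳ i ≡ proj₁ (to l) ⟨$⟩ʳ i) → k ≡ l
  injective {k} {l} eq =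
    lookup-injective (filter⁺ isDerangement? (unique-words n n))
      (trans (sym (tabulate∘lookup _)) (trans (tabulate-cong eq) (tabulate∘lookup _)))

  surjective : ∀ δ → ∃ λ k → ∀ {l} → l ≡ k → ∀ i → proj₁ (to l) ⟨$⟩ʳ i ≡ proj₁ δ ⟨$⟩ʳ i
  surjective (π , π-moves) = index v∈ , λ { refl i →
      trans (cong (λ w → Vec.lookup w i) (sym (lookup-index v∈))) (v≗π i) }
    where
    v : Vec (Fin n) n
    v = Vec.tabulate (π ⟨$⟩ʳ_)

    v≗π : ∀ i → Vec.lookup v i ≡ π ⟨$⟩ʳ i
    v≗π = lookup∘tabulate (π ⟨$⟩ʳ_)

    v-injective : ∀ {i j} → Vec.lookup v i ≡ Vec.lookup v j → i ≡ j
    v-injective {i} {j} eq = trans (sym (inverseˡ π))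
      (trans (cong (π ⟨$⟩ˡ_) (trans (sym (v≗π i)) (trans eq (v≗π j)))) (inverseˡ π))

    v-derangement : IsDerangement v
    v-derangement =
      (v-injective , strictlySurjective⇒surjective λ y → π ⟨$⟩ˡ y , trans (v≗π _) (inverseʳ π)) ,
      λ i eq → π-moves i (trans (sym (v≗π i)) eq)

    v∈ : v ∈ derangements
    v∈ = ∈-filter⁺ isDerangement? (∈-words v) v-derangement

-- Cutting 0 out of its cycle can create a fixed point only where 0 belonged to a 2-cycle, that is,
-- at `y`; hence the condition on `ρ`.
PointedSetoid : ℕ → Setoid 0ℓ 0ℓ
PointedSetoid n =
  On.setoid {B = Σ[ y ∈ Fin n ] Σ[ ρ ∈ Permutation′ n ] (∀ i → ρ ⟨$⟩ʳ i ≡ i → i ≡ y)}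
    (setoid (Fin n) ×ₛ PermutationSetoid n) (λ (y , ρ , _) → y , ρ)

module _ {S T : Setoid 0ℓ 0ℓ} where
  private
    module S = Setoid S
    module T = Setoid T

  mkInverse : (to : S.Carrier → T.Carrier) (from : T.Carrier → S.Carrier) →
              (∀ {x y} → x S.≈ y → to x T.≈ to y) → (∀ {x y} → x T.≈ y → from x S.≈ from y) →
              (∀ y → to (from y) T.≈ y) → (∀ x → from (to x) S.≈ x) → Inverse S T
  mkInverse to from to-cong from-cong invˡ invʳ = record
    { to = to ; from = from ; to-cong = to-cong ; from-cong = from-cong
    ; inverse = strictlyInverseˡ⇒inverseˡ to-cong invˡ , strictlyInverseʳ⇒inverseʳ from-cong invʳ
    }
    where open Consequences S T

-- A derangement π of n + 2 points is determined by y, where π 0 = suc y, and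
-- by the permutation of the nonzero points that results from cutting 0 out of
-- its cycle.
Derangement≅Pointed : ∀ n → Inverse (DerangementSetoid (2 + n)) (PointedSetoid (1 + n))
Derangement≅Pointed n = mkInverse to from
  (λ {x} {x′} → to-cong {x} {x′}) (λ {x} {x′} → from-cong {x} {x′}) to-from from-to
  where
  Der = Setoid.Carrier (DerangementSetoid (2 + n))
  Ptd = Setoid.Carrier (PointedSetoid (1 + n))

  τ : Fin (1 + n) → Permutation′ (2 + n)
  τ y = transpose zero (suc y)

  image : Der → Fin (1 + n)
  image (π , π-moves) = punchOut {i = zero} {π ⟨$⟩ʳ zero} (π-moves zero ∘ sym)

  suc-image : ∀ δ → suc (image δ) ≡ proj₁ δ ⟨$⟩ʳ zero
  suc-image (π , π-moves) = punchIn-punchOut (π-moves zero ∘ sym)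

  π̂ : Der → Permutation′ (2 + n)
  π̂ δ = proj₁ δ ∘ₚ flip (τ (image δ))

  cut : Der → Permutation′ (1 + n)
  cut δ = remove zero (π̂ δ)

  -- After `π`, the transposition sends `suc y` back to 0, so `π̂ δ` fixes 0 and is recovered from
  -- its restriction to the nonzero points.
  lift-cut : ∀ δ i → lift₀ (cut δ) ⟨$⟩ʳ i ≡ τ (image δ) ⟨$⟩ˡ (proj₁ δ ⟨$⟩ʳ i)
  lift-cut δ = lift₀-remove (π̂ δ)
    (trans (cong (τ (image δ) ⟨$⟩ˡ_) (sym (suc-image δ))) (inverseˡ (τ (image δ)) {zero}))

  τˡ-fix : ∀ {y} i → i ≢ y → τ y ⟨$⟩ˡ suc i ≡ suc i
  τˡ-fix {y} i i≢y with i ≟ y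
  ... | yes i≡y = contradiction i≡y i≢y
  ... | no  _   = refl

  to : Der → Ptd
  to δ = image δ , cut δ , fix
    where
    fix : ∀ i → cut δ ⟨$⟩ʳ i ≡ i → i ≡ image δ
    fix i eq with i ≟ image δ
    ... | yes i≡y = i≡y
    ... | no  i≢y = contradiction π-fix (proj₂ δ (suc i))
      where
      open ≡-Reasoning
      y = image δ
      π-fix : proj₁ δ ⟨$⟩ʳ suc i ≡ suc i
      π-fix = begin
        proj₁ δ ⟨$⟩ʳ suc i                         ≡⟨ inverseʳ (τ y) ⟨
        τ y ⟨$⟩ʳ (τ y ⟨$⟩ˡ (proj₁ δ ⟨$⟩ʳ suc i))    ≡⟨ cong (τ y ⟨$⟩ʳ_) (lift-cut δ (suc i)) ⟨
        τ y ⟨$⟩ʳ suc (cut δ ⟨$⟩ʳ i)                ≡⟨ cong (λ k → τ y ⟨$⟩ʳ suc k) eq ⟩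
        τ y ⟨$⟩ʳ suc i                             ≡⟨ cong (τ y ⟨$⟩ʳ_) (τˡ-fix i i≢y) ⟨
        τ y ⟨$⟩ʳ (τ y ⟨$⟩ˡ suc i)                  ≡⟨ inverseʳ (τ y) ⟩
        suc i                                      ∎

  from : Ptd → Der
  from (y , ρ , fix) = lift₀ ρ ∘ₚ τ y , moves
    where
    moves : ∀ i → lift₀ ρ ∘ₚ τ y ⟨$⟩ʳ i ≢ i
    -- At `zero`, and wherever `ρ` takes the value `y`, exactly one of the point and its image is
    -- `zero`, so nothing else has to be checked.
    moves (suc i) eq with ρ ⟨$⟩ʳ i ≟ y
    ... | no ρi≢y = ρi≢y (trans (suc-injective eq) (fix i (suc-injective eq)))

  to-cong : ∀ {δ δ′} → (∀ i → proj₁ δ ⟨$⟩ʳ i ≡ proj₁ δ′ ⟨$⟩ʳ i) →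
            image δ ≡ image δ′ × (∀ i → cut δ ⟨$⟩ʳ i ≡ cut δ′ ⟨$⟩ʳ i)
  to-cong {δ} {δ′} eq = y≡y′ , λ i → suc-injective
    (trans (lift-cut δ (suc i))
    (trans (cong₂ (λ y k → τ y ⟨$⟩ˡ k) y≡y′ (eq (suc i))) (sym (lift-cut δ′ (suc i)))))
    where
    y≡y′ : image δ ≡ image δ′
    y≡y′ = punchOut-cong zero (eq zero)

  from-cong : ∀ {x x′ : Ptd} →
              proj₁ x ≡ proj₁ x′ × (∀ i → proj₁ (proj₂ x) ⟨$⟩ʳ i ≡ proj₁ (proj₂ x′) ⟨$⟩ʳ i) →
              ∀ i → proj₁ (from x) ⟨$⟩ʳ i ≡ proj₁ (from x′) ⟨$⟩ʳ i
  from-cong {y , ρ , _} {_ , ρ′ , _} (refl , eq) i = cong (τ y ⟨$⟩ʳ_) (lift₀-cong ρ ρ′ eq i)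

  to-from : ∀ x → image (from x) ≡ proj₁ x × (∀ i → cut (from x) ⟨$⟩ʳ i ≡ proj₁ (proj₂ x) ⟨$⟩ʳ i)
  to-from x@(y , ρ , _) = refl , λ i → suc-injective
    (trans (lift-cut (from x) (suc i)) (inverseˡ (τ y)))

  from-to : ∀ δ i → lift₀ (cut δ) ∘ₚ τ (image δ) ⟨$⟩ʳ i ≡ proj₁ δ ⟨$⟩ʳ i
  from-to δ i = trans (cong (τ (image δ) ⟨$⟩ʳ_) (lift-cut δ i)) (inverseʳ (τ (image δ)))

-- Either `ρ` moves `y` and is itself a derangement, or it fixes `y` and becomes a derangement of
-- one point fewer once `y` is removed.
Pointed≅Derangements : ∀ n →
  Inverse (PointedSetoid (1 + n))
          (setoid (Fin (1 + n)) ×ₛ (DerangementSetoid (1 + n) ⊎ₛ DerangementSetoid n))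
Pointed≅Derangements n = mkInverse to from
  (λ {x} {x′} → to-cong {x} {x′}) (λ {x} {x′} → from-cong {x} {x′}) to-from from-to
  where
  source = PointedSetoid (1 + n)
  target = setoid (Fin (1 + n)) ×ₛ (DerangementSetoid (1 + n) ⊎ₛ DerangementSetoid n)
  open Setoid source using () renaming (Carrier to A; _≈_ to _≈₁_)
  open Setoid target using () renaming (Carrier to B; _≈_ to _≈₂_)

  remove-cong : ∀ y (ρ ρ′ : Permutation′ (1 + n)) → (∀ i → ρ ⟨$⟩ʳ i ≡ ρ′ ⟨$⟩ʳ i) →
                ∀ i → remove y ρ ⟨$⟩ʳ i ≡ remove y ρ′ ⟨$⟩ʳ i
  remove-cong y ρ ρ′ eq i = punchOut-cong₂ (eq y) (eq (punchIn y i))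
    where
    punchOut-cong₂ : ∀ {n} {i i′ j j′ : Fin (suc n)} {i≢j : i ≢ j} {i′≢j′ : i′ ≢ j′} →
                     i ≡ i′ → j ≡ j′ → punchOut i≢j ≡ punchOut i′≢j′
    punchOut-cong₂ {i = i} refl eq = punchOut-cong i eq

  insert-cong : ∀ y (σ σ′ : Permutation′ n) → (∀ i → σ ⟨$⟩ʳ i ≡ σ′ ⟨$⟩ʳ i) →
                ∀ i → insert y y σ ⟨$⟩ʳ i ≡ insert y y σ′ ⟨$⟩ʳ i
  insert-cong y σ σ′ eq i with y ≟ i
  ... | yes _ = refl
  ... | no  _ = cong (punchIn y) (eq _)

  insert-fixed : ∀ y (σ : Permutation′ n) → insert y y σ ⟨$⟩ʳ y ≡ y
  insert-fixed y σ with y ≟ y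
  ... | yes _  = refl
  ... | no y≢y = contradiction refl y≢y

  to : A → B
  to (y , ρ , fix) with ρ ⟨$⟩ʳ y ≟ y
  ... | no  ρy≢y = y , inj₁ (ρ , λ i ρi≡i → ρy≢y
      (trans (cong (ρ ⟨$⟩ʳ_) (sym (fix i ρi≡i))) (trans ρi≡i (fix i ρi≡i))))
  ... | yes ρy≡y = y , inj₂ (remove y ρ , λ i eq → punchInᵢ≢i y i (fix (punchIn y i)
      (trans (punchIn-permute ρ y i) (cong₂ punchIn ρy≡y eq))))

  from : B → A
  from (y , inj₁ (ρ , moves)) = y , ρ , λ i ρi≡i → contradiction ρi≡i (moves i)
  from (y , inj₂ (σ , moves)) = y , insert y y σ , fix
    where
    fix : ∀ i → insert y y σ ⟨$⟩ʳ i ≡ i → i ≡ y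
    fix i eq with y ≟ i
    ... | yes y≡i = sym y≡i
    ... | no  y≢i = contradiction
      (punchIn-injective y _ _ (trans eq (sym (punchIn-punchOut y≢i)))) (moves _)

  to-cong : ∀ {x x′} → x ≈₁ x′ → to x ≈₂ to x′
  to-cong {y , ρ , _} {_ , ρ′ , _} (refl , eq) with ρ ⟨$⟩ʳ y ≟ y | ρ′ ⟨$⟩ʳ y ≟ y
  ... | no  _    | no  _     = refl , inj₁ eq
  ... | no  ρy≢y | yes ρ′y≡y = contradiction (trans (eq y) ρ′y≡y) ρy≢y
  ... | yes ρy≡y | no  ρ′y≢y = contradiction (trans (sym (eq y)) ρy≡y) ρ′y≢y
  ... | yes _    | yes _     = refl , inj₂ (remove-cong y ρ ρ′ eq)

  from-cong : ∀ {x x′} → x ≈₂ x′ → from x ≈₁ from x′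
  from-cong {y , _}            (refl , inj₁ eq) = refl , eq
  from-cong {y , inj₂ (σ , _)} {_ , inj₂ (σ′ , _)} (refl , inj₂ eq) = refl , insert-cong y σ σ′ eq

  to-from : ∀ x → to (from x) ≈₂ x
  to-from (y , inj₁ (ρ , moves)) with ρ ⟨$⟩ʳ y ≟ y
  ... | no  _    = refl , inj₁ λ _ → refl
  ... | yes ρy≡y = contradiction ρy≡y (moves y)
  to-from (y , inj₂ (σ , moves)) with insert y y σ ⟨$⟩ʳ y ≟ y
  ... | no  ≢y = contradiction (insert-fixed y σ) ≢y
  ... | yes _  = refl , inj₂ (remove-insert y y σ)

  from-to : ∀ x → from (to x) ≈₁ x
  from-to (y , ρ , fix) with ρ ⟨$⟩ʳ y ≟ y
  ... | no  _    = refl , λ _ → refl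
  ... | yes ρy≡y = refl , λ i →
    trans (cong (λ k → insert y k (remove y ρ) ⟨$⟩ʳ i) (sym ρy≡y)) (insert-remove y ρ i)

d-recurrence : ∀ n → d (2 + n) ≡ (1 + n) * (d (1 + n) + d n)
d-recurrence n = ↔⇒≡ (Fin-d≅Derangement (2 + n) ⨾ Derangement≅Pointed n ⨾ Pointed≅Derangements n ⨾
  (Inverse.refl (setoid (Fin (1 + n))) ×-inverse derangements≅Fin) ⨾
  Pointwise-≡↔≡ ⨾ Inverse.sym *↔×)
  where
  infixr 4 _⨾_
  _⨾_ : ∀ {S T U : Setoid 0ℓ 0ℓ} → Inverse S T → Inverse T U → Inverse S U
  _⨾_ = Inverse.trans

  derangements≅Fin : Inverse (DerangementSetoid (1 + n) ⊎ₛ DerangementSetoid n)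
                             (setoid (Fin (d (1 + n) + d n)))
  derangements≅Fin =
    (Inverse.sym (Fin-d≅Derangement (1 + n)) ⊎-inverse Inverse.sym (Fin-d≅Derangement n)) ⨾
    Sum.Pointwise-≡↔≡ _ _ ⨾ Inverse.sym +↔⊎

-- Eventual behaviour of polynomials

Eventually : (ℕ → Set) → Set
Eventually A = ∃[ N ] (∀ {n} → N ≤ n → A n)

module _ {A B : ℕ → Set} where
  mapᵉ : (∀ {n} → A n → B n) → Eventually A → Eventually B
  mapᵉ f (N , a) = N , λ N≤n → f (a N≤n)

  _∧ᵉ_ : Eventually A → Eventually B → Eventually (λ n → A n × B n)
  (M , a) ∧ᵉ (N , b) = M ⊔ N , λ N≤n → a (ℕ.m⊔n≤o⇒m≤o M N N≤n) , b (ℕ.m⊔n≤o⇒n≤o M N N≤n)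

shiftᵉ : ∀ {A} → Eventually A → Eventually (A ∘ suc)
shiftᵉ (N , a) = N , λ N≤n → a (ℕ.m≤n⇒m≤1+n N≤n)

fromᵉ : ∀ N → Eventually (N ≤_)
fromᵉ N = N , λ N≤n → N≤n

boundedAllᵉ : ∀ {A : ℕ → ℕ → Set} → (∀ r → Eventually (A r)) →
              ∀ k → Eventually (λ n → ∀ r → r < k → A r n)
boundedAllᵉ ev zero    = 0 , λ _ _ ()
boundedAllᵉ {A} ev (suc k) = mapᵉ
  (λ a r r<1+k → split a (ℕ.m≤n⇒m<n∨m≡n (ℕ.≤-pred r<1+k))) (boundedAllᵉ ev k ∧ᵉ ev k)
  where
  split : ∀ {n r} → (∀ r → r < k → A r n) × A k n → r < k ⊎ r ≡ k → A r n
  split (below , _) (inj₁ r<k)  = below _ r<k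
  split (_ , at)    (inj₂ refl) = at

-- Horner form, imposed on functions up to pointwise equality. Recursion on it takes the place of
-- arguments by degree and leading coefficient.
data Polynomial : (ℕ → ℤ) → Set where
  null   : ∀ {f} → (∀ n → f n ≡ 0ℤ) → Polynomial f
  horner : ∀ {f g} c → Polynomial g → (∀ n → f n ≡ c ℤ.+ + n ℤ.* g n) → Polynomial f

polynomial-resp : ∀ {f g} → f ≗ g → Polynomial f → Polynomial g
polynomial-resp f≗g (null f≗0)       = null λ n → trans (sym (f≗g n)) (f≗0 n)
polynomial-resp f≗g (horner c p f≗)  = horner c p λ n → trans (sym (f≗g n)) (f≗ n)

const-polynomial : ∀ c → Polynomial (λ _ → c)
const-polynomial c = horner c (null λ _ → refl) λ n → lemma c (+ n)
  where
  lemma : ∀ c m → c ≡ c ℤ.+ m ℤ.* 0ℤ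
  lemma = ℤ-Ring.solve-∀

n*-polynomial : ∀ {f} → Polynomial f → Polynomial (λ n → + n ℤ.* f n)
n*-polynomial p = horner 0ℤ p λ n → sym (ℤ.+-identityˡ _)

+-polynomial : ∀ {f g} → Polynomial f → Polynomial g → Polynomial (λ n → f n ℤ.+ g n)
+-polynomial {g = g} (null f≗0) q =
  polynomial-resp (λ n → sym (trans (cong (ℤ._+ g n) (f≗0 n)) (ℤ.+-identityˡ (g n)))) q
+-polynomial {f} p@(horner _ _ _) (null g≗0) =
  polynomial-resp (λ n → sym (trans (cong (λ x → f n ℤ.+ x) (g≗0 n)) (ℤ.+-identityʳ (f n)))) p
+-polynomial (horner {g = f′} a p f≗) (horner {g = g′} b q g≗) =
  horner (a ℤ.+ b) (+-polynomial p q) λ n →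
    trans (cong₂ ℤ._+_ (f≗ n) (g≗ n)) (lemma a b (+ n) (f′ n) (g′ n))
  where
  lemma : ∀ a b m x y → (a ℤ.+ m ℤ.* x) ℤ.+ (b ℤ.+ m ℤ.* y) ≡ (a ℤ.+ b) ℤ.+ m ℤ.* (x ℤ.+ y)
  lemma = ℤ-Ring.solve-∀

scale-polynomial : ∀ {f} a → Polynomial f → Polynomial (λ n → a ℤ.* f n)
scale-polynomial a (null f≗0) = null λ n → trans (cong (a ℤ.*_) (f≗0 n)) (ℤ.*-zeroʳ a)
scale-polynomial a (horner {g = f′} c p f≗) =
  horner (a ℤ.* c) (scale-polynomial a p) λ n →
    trans (cong (a ℤ.*_) (f≗ n)) (lemma a c (+ n) (f′ n))
  where
  lemma : ∀ a c m x → a ℤ.* (c ℤ.+ m ℤ.* x) ≡ a ℤ.* c ℤ.+ m ℤ.* (a ℤ.* x)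
  lemma = ℤ-Ring.solve-∀

*-polynomial : ∀ {f g} → Polynomial f → Polynomial g → Polynomial (λ n → f n ℤ.* g n)
*-polynomial {g = g} (null f≗0) q = null λ n → trans (cong (ℤ._* g n) (f≗0 n)) (ℤ.*-zeroˡ (g n))
*-polynomial {g = g} (horner {g = f′} c p f≗) q =
  polynomial-resp (λ n → sym (trans (cong (ℤ._* g n) (f≗ n)) (lemma c (+ n) (f′ n) (g n))))
    (+-polynomial (scale-polynomial c q) (n*-polynomial (*-polynomial p q)))
  where
  lemma : ∀ c m x y → (c ℤ.+ m ℤ.* x) ℤ.* y ≡ c ℤ.* y ℤ.+ m ℤ.* (x ℤ.* y)
  lemma = ℤ-Ring.solve-∀

shift-polynomial : ∀ {f} → Polynomial f → Polynomial (f ∘ suc)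
shift-polynomial (null f≗0) = null (f≗0 ∘ suc)
shift-polynomial (horner {g = f′} c p f≗) =
  polynomial-resp (λ n → sym (trans (f≗ (suc n)) (lemma c (+ n) (f′ (suc n)))))
    (+-polynomial (+-polynomial (const-polynomial c) p′) (n*-polynomial p′))
  where
  p′ = shift-polynomial p
  lemma : ∀ c m x → c ℤ.+ (+ 1 ℤ.+ m) ℤ.* x ≡ (c ℤ.+ x) ℤ.+ m ℤ.* x
  lemma = ℤ-Ring.solve-∀

0<c+m : ∀ c {m} → ∣ c ∣ < m → 0ℤ ℤ.< c ℤ.+ + m
0<c+m (+ k)        k<m = ℤ.+<+ (ℕ.<-≤-trans (ℕ.≤-<-trans z≤n k<m) (ℕ.m≤n+m _ k))
0<c+m ℤ.-[1+ k ]   k<m =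
  subst (0ℤ ℤ.<_) (sym (ℤ.⊖-≥ (ℕ.<⇒≤ k<m))) (ℤ.+<+ (ℕ.m<n⇒0<n∸m k<m))

-- A positive integer is at least 1, so `n * g n ≥ n`, which outweighs `c` as soon as `n` exceeds
-- its absolute value.
horner-positive : ∀ {f g : ℕ → ℤ} c → (∀ n → f n ≡ c ℤ.+ + n ℤ.* g n) →
                  Eventually (λ n → 0ℤ ℤ.< g n) → Eventually (λ n → 0ℤ ℤ.< f n)
horner-positive {f} {g} c f≗ g>0 = mapᵉ positive (g>0 ∧ᵉ fromᵉ (suc ∣ c ∣))
  where
  positive : ∀ {n} → 0ℤ ℤ.< g n × ∣ c ∣ < n → 0ℤ ℤ.< f n
  positive {n} (g>0 , c<n) with g n | f≗ n
  positive {n} (ℤ.+<+ {n = suc m} _ , c<n) | + suc m | fn≡ =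
    subst (0ℤ ℤ.<_) (trans (cong (ℤ._+_ c) (ℤ.pos-* n (suc m))) (sym fn≡))
      (0<c+m c (ℕ.<-≤-trans c<n (ℕ.m≤m*n n (suc m))))

-- The sign of `c + n * g n` is eventually that of `g`, unless `g` eventually vanishes; then it is
-- the sign of `c`.
eventual-sign : ∀ {f} → Polynomial f →
  Eventually (λ n → 0ℤ ℤ.< f n) ⊎ Eventually (λ n → 0ℤ ℤ.< ℤ.- f n) ⊎ Eventually (λ n → f n ≡ 0ℤ)
eventual-sign (null f≗0) = inj₂ (inj₂ (0 , λ {n} _ → f≗0 n))
eventual-sign {f} (horner {g = g} c p f≗) with eventual-sign p
... | inj₁ g>0        = inj₁ (horner-positive c f≗ g>0)
... | inj₂ (inj₁ g<0) = inj₂ (inj₁ (horner-positive (ℤ.- c)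
        (λ n → trans (cong ℤ.-_ (f≗ n)) (lemma c (+ n) (g n))) g<0))
  where
  lemma : ∀ c m x → ℤ.- (c ℤ.+ m ℤ.* x) ≡ ℤ.- c ℤ.+ m ℤ.* (ℤ.- x)
  lemma = ℤ-Ring.solve-∀
... | inj₂ (inj₂ g≡0)
  with mapᵉ (λ {n} gn≡0 → trans (f≗ n) (trans (cong (λ x → c ℤ.+ + n ℤ.* x) gn≡0) (lemma c (+ n)))) g≡0
  where
  lemma : ∀ c m → c ℤ.+ m ℤ.* 0ℤ ≡ c
  lemma = ℤ-Ring.solve-∀
... | f≡c with ℤ.<-cmp 0ℤ c
... | tri< c>0 _ _ = inj₁ (mapᵉ (λ fn≡c → subst (0ℤ ℤ.<_) (sym fn≡c) c>0) f≡c)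
... | tri≈ _ 0≡c _ = inj₂ (inj₂ (mapᵉ (λ fn≡c → trans fn≡c (sym 0≡c)) f≡c))
... | tri> _ _ c<0 = inj₂ (inj₁ (mapᵉ
        (λ fn≡c → subst (λ x → 0ℤ ℤ.< ℤ.- x) (sym fn≡c) (ℤ.neg-mono-< c<0)) f≡c))

eventually-compare : ∀ {F G : ℕ → ℕ} → Polynomial (λ n → + F n) → Polynomial (λ n → + G n) →
  Eventually (λ n → G n < F n) ⊎ Eventually (λ n → F n ≤ G n)
eventually-compare {F} {G} p q with eventual-sign F-G
  where
  F-G : Polynomial (λ n → + F n ℤ.- + G n)
  F-G = +-polynomial p (polynomial-resp (λ n → ℤ.-1*i≡-i (+ G n)) (scale-polynomial ℤ.-1ℤ q))
... | inj₁ F-G>0        = inj₁ (mapᵉ (λ F-G>0 → ℕ.≰⇒> λ F≤G →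
        ℤ.≤⇒≯ (ℤ.i≤j⇒i-j≤0 (ℤ.+≤+ F≤G)) F-G>0) F-G>0)
... | inj₂ (inj₁ F-G<0) = inj₂ (mapᵉ (λ F-G<0 → ℕ.≮⇒≥ λ G<F →
        ℤ.≤⇒≯ (ℤ.neg-mono-≤ (ℤ.i≤j⇒0≤j-i (ℤ.+≤+ (ℕ.<⇒≤ G<F)))) F-G<0) F-G<0)
... | inj₂ (inj₂ F-G≡0) = inj₂ (mapᵉ
        (λ F-G≡0 → ℕ.≤-reflexive (ℤ.+-injective (ℤ.i-j≡0⇒i≡j _ _ F-G≡0))) F-G≡0)

-- Domination of polynomials by fast-growing sequences

Tame : (ℕ → ℕ) → Set
Tame h = ∃[ K ] (∀ n → h (suc n) ≤ K * h n)

polynomial-tame : ∀ {f} → Polynomial f → ∃[ h ] (Tame h × (∀ n → ∣ f n ∣ ≤ h n))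
polynomial-tame (null f≗0) =
  (λ _ → 0) , (0 , λ _ → z≤n) , λ n → ℕ.≤-reflexive (cong ∣_∣ (f≗0 n))
polynomial-tame {f} (horner {g = g} c p f≗) with h , (K , h-tame) , g≤h ← polynomial-tame p =
  -- The factor 2 comes from `n + 2 ≤ 2 * (n + 1)`; `suc K` bounds the growth of the constant
  -- summand and that of `h` at once.
  (λ n → suc n * (∣ c ∣ + h n)) , (2 * suc K , tame) , bound
  where
  open ℕ.≤-Reasoning
  tame : ∀ n → suc (suc n) * (∣ c ∣ + h (suc n)) ≤ 2 * suc K * (suc n * (∣ c ∣ + h n))
  tame n = begin
    suc (suc n) * (∣ c ∣ + h (suc n))
      ≤⟨ ℕ.*-mono-≤ (ℕ.≤-trans (s≤s (s≤s (ℕ.m≤m+n n n))) (ℕ.≤-reflexive (double n)))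
           (ℕ.+-mono-≤ (ℕ.m≤m+n ∣ c ∣ (K * ∣ c ∣)) (ℕ.≤-trans (h-tame n) (ℕ.m≤n+m _ (h n)))) ⟩
    2 * suc n * (suc K * ∣ c ∣ + suc K * h n)
      ≡⟨ rearrange (suc n) (suc K) ∣ c ∣ (h n) ⟩
    2 * suc K * (suc n * (∣ c ∣ + h n)) ∎
    where
    double : ∀ n → 2 + (n + n) ≡ 2 * suc n
    double = ℕ-Ring.solve-∀
    rearrange : ∀ m K c h → 2 * m * (K * c + K * h) ≡ 2 * K * (m * (c + h))
    rearrange = ℕ-Ring.solve-∀
  bound : ∀ n → ∣ f n ∣ ≤ suc n * (∣ c ∣ + h n)
  bound n = begin
    ∣ f n ∣                          ≡⟨ cong ∣_∣ (f≗ n) ⟩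
    ∣ c ℤ.+ + n ℤ.* g n ∣            ≤⟨ ℤ.∣i+j∣≤∣i∣+∣j∣ c (+ n ℤ.* g n) ⟩
    ∣ c ∣ + ∣ + n ℤ.* g n ∣          ≡⟨ cong (λ x → ∣ c ∣ + x) (ℤ.abs-* (+ n) (g n)) ⟩
    ∣ c ∣ + n * ∣ g n ∣              ≤⟨ ℕ.+-mono-≤ (ℕ.m≤m+n _ _) (ℕ.*-mono-≤ (ℕ.n≤1+n n) (g≤h n)) ⟩
    suc n * ∣ c ∣ + suc n * h n      ≡⟨ ℕ.*-distribˡ-+ (suc n) ∣ c ∣ (h n) ⟨
    suc n * (∣ c ∣ + h n)            ∎

-- From `2 * K` on, `z` grows at least by the factor `2 * K` per step and `h` at most by `K`, so
-- `h / z` at least halves each time.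
tame-dominated : ∀ {h z : ℕ → ℕ} → Tame h → (∀ n → 0 < z n) → (∀ n → n * z n ≤ z (suc n)) →
                 Eventually (λ n → h n ≤ z n)
tame-dominated {h} {z} (K , h-tame) z>0 z-growth =
  h₀ + N , λ {n} ≤n → subst (λ m → h m ≤ z m) (ℕ.m∸n+n≡m (ℕ.≤-trans (ℕ.m≤n+m N h₀) ≤n))
    (conclude (n ∸ N) (ℕ.m+n≤o⇒m≤o∸n h₀ ≤n))
  where
  open ℕ.≤-Reasoning
  N = 2 * K
  h₀ = h N

  -- The linear factor `suc i` replaces the available power of 2. It suffices, since `i` only has to
  -- reach `h₀`, and doubling covers its growth: `i + 2 ≤ 2 * (i + 1)`.
  compare : ∀ i → suc i * h (i + N) ≤ h₀ * z (i + N)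
  compare zero    = begin
    1 * h₀       ≡⟨ ℕ.*-comm 1 h₀ ⟩
    h₀ * 1       ≤⟨ ℕ.*-monoʳ-≤ h₀ (z>0 N) ⟩
    h₀ * z N     ∎
  compare (suc i) = begin
    suc (suc i) * h (suc i + N)      ≤⟨ ℕ.*-mono-≤ (s≤s (s≤s (ℕ.m≤m+n i i))) (h-tame (i + N)) ⟩
    (2 + (i + i)) * (K * h (i + N))  ≡⟨ rearrange i K (h (i + N)) ⟩
    N * (suc i * h (i + N))          ≤⟨ ℕ.*-mono-≤ (ℕ.m≤n+m N i) (compare i) ⟩
    (i + N) * (h₀ * z (i + N))       ≡⟨ left-comm (i + N) h₀ _ ⟩
    h₀ * ((i + N) * z (i + N))       ≤⟨ ℕ.*-monoʳ-≤ h₀ (z-growth (i + N)) ⟩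
    h₀ * z (suc i + N)               ∎
    where
    rearrange : ∀ i K h → (2 + (i + i)) * (K * h) ≡ 2 * K * (suc i * h)
    rearrange = ℕ-Ring.solve-∀
    left-comm : ∀ a b c → a * (b * c) ≡ b * (a * c)
    left-comm = ℕ-Ring.solve-∀

  conclude : ∀ i → h₀ ≤ i → h (i + N) ≤ z (i + N)
  conclude i h₀≤i = ℕ.*-cancelˡ-≤ (suc i) (begin
    suc i * h (i + N)  ≤⟨ compare i ⟩
    h₀ * z (i + N)     ≤⟨ ℕ.*-monoˡ-≤ (z (i + N)) (ℕ.m≤n⇒m≤1+n h₀≤i) ⟩
    suc i * z (i + N)  ∎)

-- The ratio operator on pairs

Pair : Set
Pair = (ℕ → ℕ) × (ℕ → ℕ)

∇ : Pair → Pair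
∇ (X , Y) = (λ n → X n * Y (suc n)) , (λ n → Y n * X (suc n))

*-polynomial-ℕ : ∀ {F G : ℕ → ℕ} → Polynomial (λ n → + F n) → Polynomial (λ n → + G n) →
                 Polynomial (λ n → + (F n * G n))
*-polynomial-ℕ {F} {G} p q = polynomial-resp (λ n → sym (ℤ.pos-* (F n) (G n))) (*-polynomial p q)

-- For positive `K`, `limit` is `P / Q ≤ 1 + 1 / K` without division; with `above` it gives
-- `P / Q → 1`. That the ratio eventually decreases is the field `above` for `∇ p`.
record Decreasing-to-1 (p : Pair) : Set where
  private
    P = proj₁ p
    Q = proj₂ p
  field
    polyˡ : Polynomial (λ n → + P n)
    polyʳ : Polynomial (λ n → + Q n)
    posˡ  : ∀ n → 0 < P n
    posʳ  : ∀ n → 0 < Q n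
    above : Eventually (λ n → Q n < P n)
    limit : ∀ K → Eventually (λ n → K * P n ≤ suc K * Q n)

open Decreasing-to-1

*-pos : ∀ {m n} → 0 < m → 0 < n → 0 < m * n
*-pos {suc m} {suc n} _ _ = s≤s z≤n

∇-decreasing-to-1 : ∀ {p} → Decreasing-to-1 p → Decreasing-to-1 (∇ p)
∇-decreasing-to-1 {p@(P , Q)} ↓1 = record
  { polyˡ = polyˡ′
  ; polyʳ = polyʳ′
  ; posˡ  = λ n → *-pos (posˡ ↓1 n) (posʳ ↓1 (suc n))
  ; posʳ  = λ n → *-pos (posʳ ↓1 n) (posˡ ↓1 (suc n))
  ; above = above′
  ; limit = λ K → mapᵉ (limit′ K) (limit ↓1 K ∧ᵉ shiftᵉ (above ↓1))
  }
  where
  open ℕ.≤-Reasoning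
  P′ = proj₁ (∇ p)
  Q′ = proj₂ (∇ p)

  polyˡ′ : Polynomial (λ n → + P′ n)
  polyˡ′ = *-polynomial-ℕ (polyˡ ↓1) (shift-polynomial (polyʳ ↓1))
  polyʳ′ : Polynomial (λ n → + Q′ n)
  polyʳ′ = *-polynomial-ℕ (polyʳ ↓1) (shift-polynomial (polyˡ ↓1))

  -- The new ratio is the old one at `n` divided by the old one at `n + 1`, which exceeds 1, so the
  -- old upper bound persists.
  limit′ : ∀ K {n} → K * P n ≤ suc K * Q n × Q (suc n) < P (suc n) → K * P′ n ≤ suc K * Q′ n
  limit′ K {n} (KP≤ , Q<P) = begin
    K * (P n * Q (suc n))      ≡⟨ ℕ.*-assoc K _ _ ⟨
    K * P n * Q (suc n)        ≤⟨ ℕ.*-mono-≤ KP≤ (ℕ.<⇒≤ Q<P) ⟩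
    suc K * Q n * P (suc n)    ≡⟨ ℕ.*-assoc (suc K) (Q n) _ ⟩
    suc K * (Q n * P (suc n))  ∎

  -- Otherwise P n / Q n would be nondecreasing from some N on, where it
  -- exceeds 1, and could not tend to 1.
  above′ : Eventually (λ n → Q′ n < P′ n)
  above′ with eventually-compare polyˡ′ polyʳ′
  ... | inj₁ Q′<P′ = Q′<P′
  -- With `y = Q N`, integrality gives `P N ≥ y + 1`, so the ratio stays at least `1 + 1 / y`. The
  -- limit taken at `y + 1` forces it down to `1 + 1 / (y + 1)`.
  ... | inj₂ P′≤Q′ with N , at ← P′≤Q′ ∧ᵉ above ↓1 with M , lim ← limit ↓1 (suc (Q N)) =
    contradiction (begin-strict
      y * (2 + y) * Q m              <⟨ ℕ.m<m+n _ (posʳ ↓1 m) ⟩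
      y * (2 + y) * Q m + Q m        ≡⟨ square y (Q m) ⟩
      suc y * (suc y * Q m)          ≤⟨ ℕ.*-monoʳ-≤ (suc y) (ℕ.*-monoˡ-≤ (Q m) (proj₂ (at ℕ.≤-refl))) ⟩
      suc y * (P N * Q m)            ≤⟨ ℕ.*-monoʳ-≤ (suc y) (nondecreasing M) ⟩
      suc y * (y * P m)              ≡⟨ left-comm (suc y) y (P m) ⟩
      y * (suc y * P m)              ≤⟨ ℕ.*-monoʳ-≤ y (lim (ℕ.m≤m+n M N)) ⟩
      y * ((2 + y) * Q m)            ≡⟨ ℕ.*-assoc y (2 + y) (Q m) ⟨
      y * (2 + y) * Q m              ∎) (ℕ.<-irrefl refl)
    where
    y = Q N
    m = M + N
    square : ∀ y q → y * (2 + y) * q + q ≡ suc y * (suc y * q)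
    square = ℕ-Ring.solve-∀
    left-comm : ∀ a b c → a * (b * c) ≡ b * (a * c)
    left-comm = ℕ-Ring.solve-∀
    nondecreasing : ∀ i → P N * Q (i + N) ≤ Q N * P (i + N)
    nondecreasing zero    = ℕ.≤-reflexive (ℕ.*-comm (P N) (Q N))
    nondecreasing (suc i) = ℕ.*-cancelʳ-≤ _ _ (Q (i + N)) {{>-nonZero (posʳ ↓1 (i + N))}} (begin
      P N * Q (suc i + N) * Q (i + N)     ≡⟨ exchange (P N) _ _ ⟩
      P N * Q (i + N) * Q (suc i + N)     ≤⟨ ℕ.*-monoˡ-≤ _ (nondecreasing i) ⟩
      Q N * P (i + N) * Q (suc i + N)     ≡⟨ ℕ.*-assoc (Q N) _ _ ⟩
      Q N * (P (i + N) * Q (suc i + N))   ≤⟨ ℕ.*-monoʳ-≤ (Q N) (proj₁ (at (ℕ.m≤n+m N i))) ⟩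
      Q N * (Q (i + N) * P (suc i + N))   ≡⟨ rotate (Q N) _ _ ⟩
      Q N * P (suc i + N) * Q (i + N)     ∎)
      where
      exchange : ∀ a b c → a * b * c ≡ a * c * b
      exchange = ℕ-Ring.solve-∀
      rotate : ∀ a b c → a * (b * c) ≡ a * c * b
      rotate = ℕ-Ring.solve-∀

∇^ : ℕ → Pair → Pair
∇^ zero    p = p
∇^ (suc r) p = ∇ (∇^ r p)

-- What ∇ (z , 1) is for z (n + 1) = (n + 4) z n, after division by z; here z n
-- stands for d (n + 3).
linear : Pair
linear = (λ _ → 1) , (λ n → 4 + n)

id-polynomial : Polynomial (λ n → + n)
id-polynomial = polynomial-resp (λ n → ℤ.*-identityʳ (+ n)) (n*-polynomial (const-polynomial (+ 1)))

-- The induction starts at `∇ linear`, whose ratio is `(n + 5) / (n + 4)`; the ratio of `linear`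
-- itself is below 1.
∇^-linear-decreasing-to-1 : ∀ s → Decreasing-to-1 (∇^ (suc s) linear)
∇^-linear-decreasing-to-1 (suc s) = ∇-decreasing-to-1 (∇^-linear-decreasing-to-1 s)
∇^-linear-decreasing-to-1 zero    = record
  { polyˡ = *-polynomial-ℕ {λ _ → 1} one (shift-polynomial 4+n)
  ; polyʳ = *-polynomial-ℕ {G = λ _ → 1} 4+n one
  ; posˡ  = λ _ → s≤s z≤n
  ; posʳ  = λ _ → s≤s z≤n
  ; above = 0 , λ {n} _ → ℕ.≤-reflexive (lemma₁ n)
  ; limit = λ K → mapᵉ (limit₁ K) (fromᵉ K)
  }
  where
  one : Polynomial (λ _ → + 1)
  one = const-polynomial (+ 1)
  4+n : Polynomial (λ n → + (4 + n))
  4+n = +-polynomial (const-polynomial (+ 4)) id-polynomial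
  lemma₁ : ∀ n → suc ((4 + n) * 1) ≡ 1 * (5 + n)
  lemma₁ = ℕ-Ring.solve-∀
  limit₁ : ∀ K {n} → K ≤ n → K * (1 * (5 + n)) ≤ suc K * ((4 + n) * 1)
  limit₁ K {n} K≤n = begin
    K * (1 * (5 + n))            ≡⟨ lemma₂ K n ⟩
    K + K * ((4 + n) * 1)        ≤⟨ ℕ.+-monoˡ-≤ _ (ℕ.≤-trans K≤n (ℕ.m≤n+m n 4)) ⟩
    4 + n + K * ((4 + n) * 1)    ≡⟨ lemma₃ K n ⟩
    suc K * ((4 + n) * 1)        ∎
    where
    open ℕ.≤-Reasoning
    lemma₂ : ∀ K n → K * (1 * (5 + n)) ≡ K + K * ((4 + n) * 1)
    lemma₂ = ℕ-Ring.solve-∀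
    lemma₃ : ∀ K n → 4 + n + K * ((4 + n) * 1) ≡ suc K * ((4 + n) * 1)
    lemma₃ = ℕ-Ring.solve-∀

-- Propagation of relative errors of order `1 / z`

module Perturbation (z : ℕ → ℕ) (z>0 : ∀ n → 0 < z n)
                    (z-step : ∀ n → ∣ z (suc n) - z n * (4 + n) ∣ ≤ 1) where

  -- Of the three copies of `z n` by which `(n + 4) * z n` exceeds the left side, one already
  -- absorbs the error 1.
  z-growth : ∀ n → suc n * z n ≤ z (suc n)
  z-growth n = ℕ.+-cancelʳ-≤ 1 _ _ (begin
    suc n * z n + 1        ≤⟨ ℕ.+-monoʳ-≤ (suc n * z n) (z>0 n) ⟩
    suc n * z n + z n      ≤⟨ ℕ.m≤m+n _ (2 * z n) ⟩
    suc n * z n + z n + 2 * z n ≡⟨ lemma n (z n) ⟩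
    z n * (4 + n)          ≤⟨ ℕ.m≤n+∣n-m∣ _ (z (suc n)) ⟩
    z (suc n) + ∣ z (suc n) - z n * (4 + n) ∣  ≤⟨ ℕ.+-monoʳ-≤ (z (suc n)) (z-step n) ⟩
    z (suc n) + 1          ∎)
    where
    open ℕ.≤-Reasoning
    lemma : ∀ n x → suc n * x + x + 2 * x ≡ x * (4 + n)
    lemma = ℕ-Ring.solve-∀

  z-mono : ∀ n → z n ≤ z (suc n)
  z-mono n = ℕ.≤-trans (ℕ.m≤m+n (z n) (n * z n)) (z-growth n)

  polynomial-dominated : ∀ {F : ℕ → ℕ} → Polynomial (λ n → + F n) → Eventually (λ n → F n ≤ z n)
  polynomial-dominated p with h , h-tame , F≤h ← polynomial-tame p =
    mapᵉ (ℕ.≤-trans (F≤h _))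
      (tame-dominated h-tame z>0 λ n → ℕ.≤-trans (ℕ.m≤n+m _ (z n)) (z-growth n))

  -- `F` equals `G` up to the relative error `c / z n`, with denominators cleared.
  record Close (c : ℕ) (F G : ℕ → ℕ) : Set where
    constructor close
    field error : ∀ n → z n * ∣ F n - G n ∣ ≤ c * G n

  open Close

  close-shift : ∀ {c F G} → Close c F G → Close c (F ∘ suc) (G ∘ suc)
  close-shift F~G = close λ n → ℕ.≤-trans (ℕ.*-monoˡ-≤ _ (z-mono n)) (error F~G (suc n))

  close-bound : ∀ {c F G} → Close c F G → ∀ n → F n ≤ suc c * G n
  close-bound {c} {F} {G} F~G n = begin
    F n                          ≤⟨ ℕ.m≤n+∣m-n∣ (F n) (G n) ⟩
    G n + ∣ F n - G n ∣          ≤⟨ ℕ.+-monoʳ-≤ (G n) (ℕ.m≤n*m _ (z n) {{>-nonZero (z>0 n)}}) ⟩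
    G n + z n * ∣ F n - G n ∣    ≤⟨ ℕ.+-monoʳ-≤ (G n) (error F~G n) ⟩
    suc c * G n                  ∎
    where open ℕ.≤-Reasoning

  -- `F F′ - G G′ = F (F′ - G′) + (F - G) G′`, where `F` is at most `(c + 1) G`.
  close-* : ∀ {c F G F′ G′} → Close c F G → Close c F′ G′ →
            Close (suc c * c + c) (λ n → F n * F′ n) (λ n → G n * G′ n)
  close-* {c} {F} {G} {F′} {G′} F~G F′~G′ = close λ n → begin
    z n * ∣ F n * F′ n - G n * G′ n ∣
      ≤⟨ ℕ.*-monoʳ-≤ (z n) (ℕ.∣-∣-triangle (F n * F′ n) (F n * G′ n) (G n * G′ n)) ⟩
    z n * (∣ F n * F′ n - F n * G′ n ∣ + ∣ F n * G′ n - G n * G′ n ∣)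
      ≡⟨ cong₂ (λ a b → z n * (a + b)) (ℕ.*-distribˡ-∣-∣ (F n) _ _) (ℕ.*-distribʳ-∣-∣ (G′ n) (F n) (G n)) ⟨
    z n * (F n * ∣ F′ n - G′ n ∣ + ∣ F n - G n ∣ * G′ n)
      ≡⟨ lemma₁ (z n) (F n) _ _ (G′ n) ⟩
    F n * (z n * ∣ F′ n - G′ n ∣) + z n * ∣ F n - G n ∣ * G′ n
      ≤⟨ ℕ.+-mono-≤ (ℕ.*-mono-≤ (close-bound F~G n) (error F′~G′ n)) (ℕ.*-monoˡ-≤ (G′ n) (error F~G n)) ⟩
    suc c * G n * (c * G′ n) + c * G n * G′ n
      ≡⟨ lemma₂ c (G n) (G′ n) ⟩
    (suc c * c + c) * (G n * G′ n) ∎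
    where
    open ℕ.≤-Reasoning
    lemma₁ : ∀ z f a b g → z * (f * a + b * g) ≡ f * (z * a) + z * b * g
    lemma₁ = ℕ-Ring.solve-∀
    lemma₂ : ∀ c g g′ → suc c * g * (c * g′) + c * g * g′ ≡ (suc c * c + c) * (g * g′)
    lemma₂ = ℕ-Ring.solve-∀

  -- Only the ratio of a pair matters, so a common positive factor `W` is allowed; it need not be
  -- polynomial.
  Approximates : Pair → Pair → Set
  Approximates (X , Y) (P , Q) = Σ[ W ∈ (ℕ → ℕ) ] ∃[ c ]
    ((∀ n → 0 < W n) × Close c X (λ n → W n * P n) × Close c Y (λ n → W n * Q n))

  ∇-approximates : ∀ {p q} → Approximates p q → Approximates (∇ p) (∇ q)
  ∇-approximates {p} {P , Q} (W , c , W>0 , X~ , Y~) = (λ n → W n * W (suc n)) , _ ,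
    (λ n → *-pos (W>0 n) (W>0 (suc n))) ,
    close-resp (λ n → lemma (W n) _ _ _) (close-* X~ (close-shift Y~)) ,
    close-resp (λ n → lemma (W n) _ _ _) (close-* Y~ (close-shift X~))
    where
    close-resp : ∀ {c F G H} → G ≗ H → Close c F G → Close c F H
    close-resp {c} {F} G≗H F~G = close λ n →
      subst (λ g → z n * ∣ F n - g ∣ ≤ c * g) (G≗H n) (error F~G n)
    lemma : ∀ w p w′ q → w * p * (w′ * q) ≡ w * w′ * (p * q)
    lemma = ℕ-Ring.solve-∀

  ∇^-approximates : ∀ s → Approximates (∇^ (suc s) (z , λ _ → 1)) (∇^ s linear)
  ∇^-approximates (suc s) = ∇-approximates (∇^-approximates s)
  -- With `W = z` the first components agree exactly, and the second differ by at most 1.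
  ∇^-approximates zero    = z , 1 , z>0 , close closeˡ , close closeʳ
    where
    open ℕ.≤-Reasoning
    closeˡ : ∀ n → z n * ∣ z n * 1 - z n * 1 ∣ ≤ 1 * (z n * 1)
    closeˡ n rewrite ℕ.∣n-n∣≡0 (z n * 1) | ℕ.*-zeroʳ (z n) = z≤n
    closeʳ : ∀ n → z n * ∣ 1 * z (suc n) - z n * (4 + n) ∣ ≤ 1 * (z n * (4 + n))
    closeʳ n = begin
      z n * ∣ 1 * z (suc n) - z n * (4 + n) ∣  ≡⟨ cong (λ x → z n * ∣ x - z n * (4 + n) ∣) (ℕ.*-identityˡ (z (suc n))) ⟩
      z n * ∣ z (suc n) - z n * (4 + n) ∣      ≤⟨ ℕ.*-monoʳ-≤ (z n) (ℕ.≤-trans (z-step n) (s≤s z≤n)) ⟩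
      z n * (4 + n)                            ≡⟨ ℕ.*-identityˡ _ ⟨
      1 * (z n * (4 + n))                      ∎

  -- The gap `W (P - Q)` is at least `W` by integrality, while the two errors add up to at most
  -- `W c (P + Q) / z`, which is at most `W` once `z` dominates the polynomial `c (P + Q)`.
  approximates-above : ∀ {p q} → Approximates p q → Decreasing-to-1 q →
                       Eventually (λ n → proj₂ p n ≤ proj₁ p n)
  approximates-above {X , Y} {P , Q} (W , c , W>0 , X~ , Y~) ↓1 =
    mapᵉ compare (above ↓1 ∧ᵉ polynomial-dominated c[P+Q])
    where
    open ℕ.≤-Reasoning
    c[P+Q] : Polynomial (λ n → + (c * (P n + Q n)))
    c[P+Q] = *-polynomial-ℕ {λ _ → c} {λ n → P n + Q n}
      (const-polynomial (+ c)) (+-polynomial (polyˡ ↓1) (polyʳ ↓1))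

    compare : ∀ {n} → Q n < P n × c * (P n + Q n) ≤ z n → Y n ≤ X n
    compare {n} (Q<P , c[P+Q]≤z) = ℕ.*-cancelˡ-≤ (z n) {{>-nonZero (z>0 n)}}
      (ℕ.+-cancelʳ-≤ (c * WP) _ _ (begin
        z n * Y n + c * WP
          ≤⟨ ℕ.+-monoˡ-≤ (c * WP) (ℕ.*-monoʳ-≤ (z n) (ℕ.m≤n+∣m-n∣ (Y n) WQ)) ⟩
        z n * (WQ + ∣ Y n - WQ ∣) + c * WP
          ≡⟨ cong (_+ c * WP) (ℕ.*-distribˡ-+ (z n) WQ _) ⟩
        z n * WQ + z n * ∣ Y n - WQ ∣ + c * WP
          ≤⟨ ℕ.+-monoˡ-≤ (c * WP) (ℕ.+-monoʳ-≤ (z n * WQ) (error Y~ n)) ⟩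
        z n * WQ + c * WQ + c * WP
          ≡⟨ lemma₁ (z n) (W n) (P n) (Q n) c ⟩
        W n * (z n * Q n + c * (P n + Q n))
          ≤⟨ ℕ.*-monoʳ-≤ (W n) (ℕ.+-monoʳ-≤ (z n * Q n) c[P+Q]≤z) ⟩
        W n * (z n * Q n + z n)
          ≡⟨ lemma₂ (W n) (z n) (Q n) ⟩
        z n * (W n * suc (Q n))
          ≤⟨ ℕ.*-monoʳ-≤ (z n) (ℕ.*-monoʳ-≤ (W n) Q<P) ⟩
        z n * WP
          ≤⟨ ℕ.*-monoʳ-≤ (z n) (ℕ.m≤n+∣n-m∣ WP (X n)) ⟩
        z n * (X n + ∣ X n - WP ∣)
          ≡⟨ ℕ.*-distribˡ-+ (z n) (X n) _ ⟩
        z n * X n + z n * ∣ X n - WP ∣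
          ≤⟨ ℕ.+-monoʳ-≤ (z n * X n) (error X~ n) ⟩
        z n * X n + c * WP ∎))
      where
      WP = W n * P n
      WQ = W n * Q n
      lemma₁ : ∀ z w p q c → z * (w * q) + c * (w * q) + c * (w * p) ≡ w * (z * q + c * (p + q))
      lemma₁ = ℕ-Ring.solve-∀
      lemma₂ : ∀ w z q → w * (z * q + z) ≡ z * (w * suc q)
      lemma₂ = ℕ-Ring.solve-∀

  ∇^-above : ∀ r → Eventually (λ n →
    proj₂ (∇^ (2 + r) (z , λ _ → 1)) n ≤ proj₁ (∇^ (2 + r) (z , λ _ → 1)) n)
  ∇^-above r = approximates-above (∇^-approximates (suc r)) (∇^-linear-decreasing-to-1 r)

-- From derangement numbers to log-monotonicity

-- The recurrence gives `c - (n + 2) b = - (b - (n + 1) a)`: the deviation keeps its size 1 and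
-- changes sign.
step-from-recurrence : ∀ n {a b c} → c ≡ suc n * (b + a) →
  b ≡ suc n * a + 1 ⊎ b + 1 ≡ suc n * a →
  c ≡ suc (suc n) * b + 1 ⊎ c + 1 ≡ suc (suc n) * b
step-from-recurrence n {a} refl (inj₁ refl) = inj₂ (lemma n a)
  where
  lemma : ∀ n a → suc n * (suc n * a + 1 + a) + 1 ≡ suc (suc n) * (suc n * a + 1)
  lemma = ℕ-Ring.solve-∀
step-from-recurrence n {a} {b} refl (inj₂ down) = inj₁ (begin
  suc n * (b + a)          ≡⟨ ℕ.*-distribˡ-+ (suc n) b a ⟩
  suc n * b + suc n * a    ≡⟨ cong (λ x → suc n * b + x) down ⟨
  suc n * b + (b + 1)      ≡⟨ lemma n b ⟩
  suc (suc n) * b + 1      ∎)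
  where
  open ≡-Reasoning
  lemma : ∀ n b → suc n * b + (b + 1) ≡ suc (suc n) * b + 1
  lemma = ℕ-Ring.solve-∀

d-step : ∀ n → d (suc n) ≡ suc n * d n + 1 ⊎ d (suc n) + 1 ≡ suc n * d n
-- By evaluation, `d 0 = 1` and `d 1 = 0`.
d-step zero    = inj₂ refl
d-step (suc n) = step-from-recurrence n (d-recurrence n) (d-step n)

off-by-one : ∀ {a b} → a ≡ b + 1 ⊎ a + 1 ≡ b → ∣ a - b ∣ ≤ 1
off-by-one {b = b} (inj₁ refl) = ℕ.≤-reflexive (trans (ℕ.∣-∣-comm (b + 1) b) (ℕ.∣m-m+n∣≡n b 1))
off-by-one {a}     (inj₂ refl) = ℕ.≤-reflexive (ℕ.∣m-m+n∣≡n a 1)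

z : ℕ → ℕ
z n = d (3 + n)

z-step : ∀ n → ∣ z (suc n) - z n * (4 + n) ∣ ≤ 1
z-step n = subst (λ b → ∣ z (suc n) - b ∣ ≤ 1) (ℕ.*-comm (4 + n) (z n)) (off-by-one (d-step (3 + n)))

z>0 : ∀ n → 0 < z n
z>0 n = d>0 {3 + n} (s≤s (s≤s z≤n))

-- Over an abstract monoid, since conversion checking would unfold the
-- arithmetic of ℚ.
module Regrouping {c ℓ} (M : CommutativeMonoid c ℓ) where
  private module M = CommutativeMonoid M
  open M using (_∙_; _≈_; ∙-cong; ∙-congˡ; ∙-congʳ)
  open import Algebra.Solver.CommutativeMonoid M using (solve; _⊕_; _⊜_)

  regroup-R : ∀ r a y y′ → r ∙ ((a ∙ y) ∙ y′) ≈ y ∙ ((r ∙ a) ∙ y′)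
  regroup-R = solve 4 (λ r a y y′ → r ⊕ ((a ⊕ y) ⊕ y′) ⊜ y ⊕ ((r ⊕ a) ⊕ y′)) M.refl

  outer-product : ∀ {x₀ x₂} a c y₀ y₁ y₂ → a ∙ y₀ ≈ x₀ → c ∙ y₂ ≈ x₂ →
    (a ∙ c) ∙ ((y₀ ∙ y₂) ∙ (y₁ ∙ y₁)) ≈ (x₀ ∙ y₁) ∙ (y₁ ∙ x₂)
  outer-product a c y₀ y₁ y₂ eq₀ eq₂ = M.trans
    (solve 5 (λ a c y₀ y₁ y₂ →
      (a ⊕ c) ⊕ ((y₀ ⊕ y₂) ⊕ (y₁ ⊕ y₁)) ⊜ ((a ⊕ y₀) ⊕ y₁) ⊕ (y₁ ⊕ (c ⊕ y₂))) M.refl a c y₀ y₁ y₂)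
    (∙-cong (∙-congʳ eq₀) (∙-congˡ eq₂))

  inner-product : ∀ {x₁} b y₀ y₁ y₂ → b ∙ y₁ ≈ x₁ →
    (b ∙ b) ∙ ((y₀ ∙ y₂) ∙ (y₁ ∙ y₁)) ≈ (y₀ ∙ x₁) ∙ (x₁ ∙ y₂)
  inner-product b y₀ y₁ y₂ eq₁ = M.trans
    (solve 4 (λ b y₀ y₁ y₂ →
      (b ⊕ b) ⊕ ((y₀ ⊕ y₂) ⊕ (y₁ ⊕ y₁)) ⊜ (y₀ ⊕ (b ⊕ y₁)) ⊕ ((b ⊕ y₁) ⊕ y₂)) M.refl b y₀ y₁ y₂)
    (∙-cong (∙-congˡ eq₁) (∙-congʳ eq₁))

open Regrouping ℚ.*-1-commutativeMonoid

-- Sequences of positive rationals as ratios of naturals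

ι : ℕ → ℚ
ι n = + n / 1

-- Division by 1 goes through a gcd that does not reduce for a variable `n`; in constructor form,
-- products and comparisons compute.
ι≡mkℚ : ∀ n → ι n ≡ mkℚ (+ n) 0 (Coprimality.sym (1-coprimeTo n))
ι≡mkℚ n = ℚ.normalize-coprime (Coprimality.sym (1-coprimeTo n))

ι-* : ∀ m n → ι (m * n) ≡ ι m ℚ.* ι n
ι-* m n = trans (cong (_/ 1) (ℤ.pos-* m n)) (sym (cong₂ ℚ._*_ (ι≡mkℚ m) (ι≡mkℚ n)))

ι-mono : ∀ {m n} → m ≤ n → ι m ℚ.≤ ι n
ι-mono {m} {n} m≤n = subst₂ ℚ._≤_ (sym (ι≡mkℚ m)) (sym (ι≡mkℚ n))
  (ℚ.*≤* (ℤ.*-monoʳ-≤-nonNeg (+ 1) (ℤ.+≤+ m≤n)))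

ι>0 : ∀ {n} → 0 < n → 0ℚ ℚ.< ι n
ι>0 {n} n>0 = ℚ.positive⁻¹ (ι n) {{ℚ.normalize-pos n 1 {{_}} {{>-nonZero n>0}}}}

ℚ-*-pos : ∀ {p q} → 0ℚ ℚ.< p → 0ℚ ℚ.< q → 0ℚ ℚ.< p ℚ.* q
ℚ-*-pos {p} {q} p>0 q>0 =
  ℚ.positive⁻¹ (p ℚ.* q) {{ℚ.pos*pos⇒pos p {{ℚ.positive p>0}} q {{ℚ.positive q>0}}}}

R-value : ∀ x n → value (R x n) ℚ.* value (x n) ≡ value (x (suc n))
R-value x n = trans (ℚ.*-assoc b (ℚ.1/ a) a)
  (trans (cong (b ℚ.*_) (ℚ.*-inverseˡ a)) (ℚ.*-identityʳ b))
  where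
  a = value (x n)
  b = value (x (suc n))
  instance
    _ = value>0 (x n)
    _ = ℚ.pos⇒nonZero a

PositivePair : Pair → Set
PositivePair (X , Y) = (∀ n → 0 < X n) × (∀ n → 0 < Y n)

∇^-positive : ∀ {p} → PositivePair p → ∀ r → PositivePair (∇^ r p)
∇^-positive p>0 zero    = p>0
∇^-positive p>0 (suc r) with X>0 , Y>0 ← ∇^-positive p>0 r =
  (λ n → *-pos (X>0 n) (Y>0 (suc n))) , (λ n → *-pos (Y>0 n) (X>0 (suc n)))

-- The equation `x n = X / Y`, cross-multiplied. The pair is read at `N + n` because a sequence
-- starting at `N` is stored from index 0.
record IsRatio (N : ℕ) (x : PositiveSequence) (p : Pair) : Set where
  constructor ratio
  field cross : ∀ n → value (x n) ℚ.* ι (proj₂ p (N + n)) ≡ ι (proj₁ p (N + n))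

open IsRatio

module _ {N : ℕ} where
  ratio-suc : ∀ {x} p → IsRatio N x p → IsRatio N (x ∘ suc) (proj₁ p ∘ suc , proj₂ p ∘ suc)
  ratio-suc {x} (X , Y) x≐ = ratio λ n →
    subst (λ m → value (x (suc n)) ℚ.* ι (Y m) ≡ ι (X m)) (ℕ.+-suc N n) (cross x≐ (suc n))

  R-ratio : ∀ {x} p → IsRatio N x p → IsRatio N (R x) (swap (∇ p))
  R-ratio {x} p@(X , Y) x≐ = ratio λ n →
    let m = N + n; r = value (R x n); a = value (x n) in begin
    r ℚ.* ι (X m * Y (suc m))
      ≡⟨ cong (r ℚ.*_) (ι-* (X m) (Y (suc m))) ⟩
    r ℚ.* (ι (X m) ℚ.* ι (Y (suc m)))
      ≡⟨ cong (λ q → r ℚ.* (q ℚ.* ι (Y (suc m)))) (cross x≐ n) ⟨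
    r ℚ.* (a ℚ.* ι (Y m) ℚ.* ι (Y (suc m)))
      ≡⟨ regroup-R r a (ι (Y m)) (ι (Y (suc m))) ⟩
    ι (Y m) ℚ.* (r ℚ.* a ℚ.* ι (Y (suc m)))
      ≡⟨ cong (λ q → ι (Y m) ℚ.* (q ℚ.* ι (Y (suc m)))) (R-value x n) ⟩
    ι (Y m) ℚ.* (value (x (suc n)) ℚ.* ι (Y (suc m)))
      ≡⟨ cong (ι (Y m) ℚ.*_) (cross (ratio-suc p x≐) n) ⟩
    ι (Y m) ℚ.* ι (X (suc m))
      ≡⟨ ι-* (Y m) (X (suc m)) ⟨
    ι (Y m * X (suc m)) ∎
    where open ≡-Reasoning

  -- Each `R` contributes a `swap`, and `swap (∇ (swap p))` is `∇ p`, so swaps cancel in pairs and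
  -- one survives exactly for odd `r`.
  iterated-R-ratio : ∀ {x p} → IsRatio N x p → ∀ r →
    (∃[ j ] (r ≡ 2 * j     × IsRatio N ((PositiveSequence ^ R) r x) (∇^ r p))) ⊎
    (∃[ j ] (r ≡ 1 + 2 * j × IsRatio N ((PositiveSequence ^ R) r x) (swap (∇^ r p))))
  iterated-R-ratio x≐ zero = inj₁ (0 , refl , x≐)
  iterated-R-ratio {x} {p} x≐ (suc r) with iterated-R-ratio x≐ r
  ... | inj₁ (j , refl , xᵣ≐) = inj₂ (j , refl , R-ratio (∇^ r p) xᵣ≐)
  ... | inj₂ (j , refl , xᵣ≐) = inj₁ (suc j , double j , R-ratio (swap (∇^ r p)) xᵣ≐)
    where
    double : ∀ j → 2 + 2 * j ≡ 2 * suc j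
    double = ℕ-Ring.solve-∀

  -- The ratio of `∇ (∇ p)` is that of `x n * x (n + 2)` to the square of `x (n + 1)`, so one
  -- comparison of naturals decides log-convexity at `n`.
  clear-denominators : ∀ {x} p → PositivePair p → IsRatio N x p → ∀ n →
    Σ[ K ∈ ℚ ] 0ℚ ℚ.< K ×
      value (x n) ℚ.* value (x (2 + n)) ℚ.* K ≡ ι (proj₁ (∇ (∇ p)) (N + n)) ×
      value (x (1 + n)) ℚ.* value (x (1 + n)) ℚ.* K ≡ ι (proj₂ (∇ (∇ p)) (N + n))
  clear-denominators {x} p@(X , Y) (_ , Y>0) x≐ n =
    K , K>0 ,
    trans (outer-product (value (x n)) (value (x (2 + n))) y₀ y₁ y₂
            (cross x≐ n) (cross (ratio-suc (X ∘ suc , Y ∘ suc) (ratio-suc p x≐)) n))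
          (sym (ι-*⁴ (X m) (Y (1 + m)) (Y (1 + m)) (X (2 + m)))) ,
    trans (inner-product (value (x (1 + n))) y₀ y₁ y₂ (cross (ratio-suc p x≐) n))
          (sym (ι-*⁴ (Y m) (X (1 + m)) (X (1 + m)) (Y (2 + m))))
    where
    m = N + n
    y₀ = ι (Y m)
    y₁ = ι (Y (1 + m))
    y₂ = ι (Y (2 + m))
    K = y₀ ℚ.* y₂ ℚ.* (y₁ ℚ.* y₁)

    K>0 : 0ℚ ℚ.< K
    K>0 = ℚ-*-pos (ℚ-*-pos (ι>0 (Y>0 m)) (ι>0 (Y>0 (2 + m))))
                  (ℚ-*-pos (ι>0 (Y>0 (1 + m))) (ι>0 (Y>0 (1 + m))))

    ι-*⁴ : ∀ a b c e → ι (a * b * (c * e)) ≡ ι a ℚ.* ι b ℚ.* (ι c ℚ.* ι e)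
    ι-*⁴ a b c e = trans (ι-* (a * b) (c * e)) (cong₂ ℚ._*_ (ι-* a b) (ι-* c e))

  ratio-logConvex : ∀ {x} p → PositivePair p → IsRatio N x p →
    (∀ n → proj₂ (∇ (∇ p)) (N + n) ≤ proj₁ (∇ (∇ p)) (N + n)) → LogConvex x
  ratio-logConvex p p>0 x≐ Y≤X n =
    let K , K>0 , outer , inner = clear-denominators p p>0 x≐ n in
    ℚ.*-cancelʳ-≤-pos K {{ℚ.positive K>0}} (subst₂ ℚ._≤_ (sym inner) (sym outer) (ι-mono (Y≤X n)))

  -- Swapping `p` also swaps `∇ (∇ p)`, so the inequality that gives log-convexity for `p` gives
  -- log-concavity for the reciprocal.
  ratio-logConcave : ∀ {x} p → PositivePair p → IsRatio N x (swap p) →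
    (∀ n → proj₂ (∇ (∇ p)) (N + n) ≤ proj₁ (∇ (∇ p)) (N + n)) → LogConcave x
  ratio-logConcave p p>0 x≐ Y≤X n =
    let K , K>0 , outer , inner = clear-denominators (swap p) (swap p>0) x≐ n in
    ℚ.*-cancelʳ-≤-pos K {{ℚ.positive K>0}} (subst₂ ℚ._≤_ (sym outer) (sym inner) (ι-mono (Y≤X n)))

  ratio-logMonotonic : ∀ {x} p → PositivePair p → IsRatio N x p → ∀ k →
    (∀ n r → r < k → proj₂ (∇^ (2 + r) p) (N + n) ≤ proj₁ (∇^ (2 + r) p) (N + n)) →
    LogMonotonic k x
  ratio-logMonotonic {x} p p>0 x≐ k above r r<k = byParity (iterated-R-ratio x≐ r)
    where
    pᵣ = ∇^ r p
    xᵣ = (PositiveSequence ^ R) r x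

    byParity : (∃[ j ] (r ≡ 2 * j × IsRatio N xᵣ pᵣ)) ⊎
               (∃[ j ] (r ≡ 1 + 2 * j × IsRatio N xᵣ (swap pᵣ))) →
               (2 ∤ r → LogConcave xᵣ) × (2 ∣ r → LogConvex xᵣ)
    byParity (inj₁ (j , r≡2j , xᵣ≐)) =
      (λ 2∤r → contradiction (divides j (trans r≡2j (ℕ.*-comm 2 j))) 2∤r) ,
      (λ _ → ratio-logConvex pᵣ (∇^-positive p>0 r) xᵣ≐ λ n → above n r r<k)
    byParity (inj₂ (j , r≡1+2j , xᵣ≐)) =
      (λ _ → ratio-logConcave pᵣ (∇^-positive p>0 r) xᵣ≐ λ n → above n r r<k) ,
      (λ (divides q r≡q*2) → contradiction
        (trans (ℕ.*-comm 2 q) (trans (sym r≡q*2) r≡1+2j)) (ℕ.even≢odd q j))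

open Perturbation z z>0 z-step using (∇^-above)

derangements-ratio : ∀ N N≥3 → IsRatio N (derangementsFrom (3 + N) N≥3) (z , λ _ → 1)
derangements-ratio N N≥3 = ratio λ n → ℚ.*-identityʳ (ι (z (N + n)))

theorem3p1 : (k : ℕ) → ∃[ N ] Σ[ N≥3 ∈ N ≥ 3 ] LogMonotonic k (derangementsFrom N N≥3)
-- The threshold `N` refers to `z`, whose index lags that of `d` by 3; adding 3 also secures the
-- lower bound required of the starting index.
theorem3p1 k = 3 + N , N≥3 ,
  ratio-logMonotonic (z , λ _ → 1) (z>0 , λ _ → s≤s z≤n) (derangements-ratio N N≥3)
    k (λ n → proj₂ dominated (ℕ.m≤m+n N n))
  where
  dominated : Eventually (λ n → ∀ r → r < k →
            proj₂ (∇^ (2 + r) (z , λ _ → 1)) n ≤ proj₁ (∇^ (2 + r) (z , λ _ → 1)) n)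
  dominated = boundedAllᵉ ∇^-above k

  N = proj₁ dominated

  N≥3 : 3 + N ≥ 3
  N≥3 = ℕ.m≤m+n 3 N
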